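{- Let $p$ be the POP of size $3$ on $\{1,2,3\}$ whose only relation is $3<_p2$ (so $1$ is isolated), and let $p'$ be the POP of size $3$ whose only relation is $2<_{p'}3$. Then $p\sim_s p'$. Equivalently, the set of classical patterns $\{132,231,321\}$ is shape-Wilf-equivalent to the set $\{123,213,312\}$: for every Ferrers board $\lambda$, the number of transversals of $\lambda$ avoiding all of $132,231,321$ equals the number of transversals avoiding all of $123,213,312$.
   Context: A partially ordered pattern (POP) $p$ of size $m$ is a partial order $\le_p$ on $[m]$. A Ferrers board $\lambda=(\lambda_1\ge\dots\ge\lambda_n>0)$ with $\lambda_1=n$ is drawn in French notation: rows numbered $1,\dots,n$ from bottom to top, row $i$ consisting of cells $(i,1),\dots,(i,\lambda_i)$. A transversal of $\lambda$ is a $0/1$-filling of its cells with exactly one $1$ in each row and column. A transversal $T$ contains a POP $p$ of size $m$ if there are rows $r_1<\dots<r_m$ and columns $c_1<\dots<c_m$ such that every cell $(r_a,c_b)$ lies in $\lambda$ and the $1$ of column $c_b$ lies in row $r_{\sigma(b)}$ for each $b$ (so $\sigma\in\mathfrak S_m$), with $\sigma(j)<\sigma(j')$ whenever $j<_p j'$; $T$ contains a classical pattern $\alpha\in\mathfrak S_m$ if this holds with $\sigma=\alpha$. Otherwise $T$ avoids it. Two POPs (or sets of patterns) are shape-Wilf-equivalent, $\sim_s$, if for every Ferrers board the numbers of avoiding transversals coincide. -}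

module Defs where

open import Data.Bool.Base using (Bool; true; false)
open import Data.Bool.Properties as Bool using ()
open import Data.Fin.Base using (Fin; toℕ; fromℕ<; _<_)
open import Data.Fin.Patterns using (0F; 1F; 2F)
open import Data.Fin.Properties as Fin using (any?; all?)
open import Data.List.Base as List using (List; cartesianProductWith; filter; length)
open import Data.List.Membership.Propositional using (_∈_)
open import Data.List.Membership.Propositional.Properties using (∈-cartesianProductWith⁺)
open import Data.List.Relation.Unary.All as ListAll using ()
open import Data.List.Relation.Unary.Any using (here; there)
open import Data.List.Relation.Unary.Unique.Propositional as ListUnique using ()
open import Data.List.Relation.Unary.Unique.Propositional.Properties using (cartesianProductWith⁺)
open import Data.Nat.Base as ℕ using (ℕ; zero; suc)
open import Data.Nat.Properties as ℕ using ()
open import Data.Product using (Σ; ∃; ∃₂; ∃!; _×_; _,_; proj₁; proj₂)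
open import Data.Sum.Base using (_⊎_; inj₁; inj₂)
open import Data.Vec.Base using (Vec; []; _∷_; lookup)
open import Data.Vec.Relation.Unary.All using (All; []; _∷_)
open import Data.Vec.Relation.Unary.All.Properties using (lookup⁺)
open import Data.Vec.Relation.Unary.AllPairs using (AllPairs; allPairs?)
open import Data.Vec.Relation.Unary.Unique.Propositional using (Unique)
open import Level using (0ℓ)
open import Relation.Binary.Core using (Rel)
open import Relation.Binary.PropositionalEquality using (_≡_; _≢_; refl; sym; isEquivalence)
open import Relation.Binary.Structures using (IsDecPartialOrder)
open import Relation.Nullary.Decidable using (Dec; yes; no; True; toWitness; map′; ¬?; _×-dec_; _⊎-dec_; _→-dec_)
open import Relation.Nullary.Negation using (¬_; contradiction)
open import Relation.Unary using (Pred; Decidable)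

-- French notation, with rows and columns numbered from 0: row 0 is the
-- bottom row. The empty board (n = 0) is allowed, its first row having
-- length 0.

firstRow : ∀ {n} → Vec ℕ n → ℕ
firstRow []      = 0
firstRow (l ∷ _) = l

record FerrersBoard (n : ℕ) : Set where
  field
    rows       : Vec ℕ n
    decreasing : AllPairs ℕ._≥_ rows
    positive   : All (0 ℕ.<_) rows
    square     : firstRow rows ≡ n

open FerrersBoard public

InBoard : ∀ {n} → FerrersBoard n → Fin n → Fin n → Set
InBoard B i j = toℕ j ℕ.< lookup (rows B) i

inBoard? : ∀ {n} (B : FerrersBoard n) i j → Dec (InBoard B i j)
inBoard? B i j = toℕ j ℕ.<? lookup (rows B) i

-- A row of length l is filled by a vector of l bits, so a filling assigns
-- a bit to each cell of the board and to nothing else.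
Filling : ∀ {n} → FerrersBoard n → Set
Filling B = All (Vec Bool) (rows B)

entry : ∀ {n} {B : FerrersBoard n} → Filling B → ∀ i j → .(InBoard B i j) → Bool
entry T i j j<λᵢ = lookup (lookup⁺ T i) (fromℕ< j<λᵢ)

One : ∀ {n} {B : FerrersBoard n} → Filling B → Fin n → Fin n → Set
One {B = B} T i j = Σ (InBoard B i j) λ j<λᵢ → entry {B = B} T i j j<λᵢ ≡ true

IsTransversal : ∀ {n} {B : FerrersBoard n} → Filling B → Set
IsTransversal {B = B} T =
  (∀ i → ∃! _≡_ λ j → One {B = B} T i j) ×
  (∀ j → ∃! _≡_ λ i → One {B = B} T i j)

one? : ∀ {n} {B : FerrersBoard n} (T : Filling B) i j → Dec (One {B = B} T i j)
one? {B = B} T i j with inBoard? B i j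
... | no ¬p = no λ where (p , _) → ¬p p
... | yes p = map′ (p ,_) proj₂ (entry {B = B} T i j p Bool.≟ true)

∃!? : ∀ {n} {P : Pred (Fin n) 0ℓ} → Decidable P → Dec (∃! _≡_ P)
∃!? P? = map′ (λ where (x , px , u) → x , px , λ {y} → u y)
              (λ where (x , px , u) → x , px , λ y → u {y})
              (any? λ x → P? x ×-dec all? λ y → P? y →-dec x Fin.≟ y)

isTransversal? : ∀ {n} {B : FerrersBoard n} → Decidable (IsTransversal {B = B})
isTransversal? {B = B} T =
  all? (λ i → ∃!? λ j → one? {B = B} T i j) ×-dec
  all? (λ j → ∃!? λ i → one? {B = B} T i j)

-- A permutation in one-line notation, with letters 0, …, m - 1.
record Pattern (m : ℕ) : Set where
  constructor mkPattern
  field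
    word     : Vec (Fin m) m
    distinct : Unique word

  infix 9 _⟨$⟩_
  _⟨$⟩_ : Fin m → Fin m
  _⟨$⟩_ = lookup word

open Pattern public

unique? : ∀ {m k} → Decidable (Unique {A = Fin m} {k})
unique? = allPairs? λ i j → ¬? (i Fin.≟ j)

-- Decidability of the order, automatic classically on a finite set, is
-- what makes the number of avoiding transversals computable.
record POP (m : ℕ) : Set₁ where
  field
    _≤ₚ_              : Rel (Fin m) 0ℓ
    isDecPartialOrder : IsDecPartialOrder _≡_ _≤ₚ_

  open IsDecPartialOrder isDecPartialOrder public using (_≤?_)

  infix 4 _≤ₚ_ _<ₚ_
  _<ₚ_ : Rel (Fin m) 0ℓ
  i <ₚ j = i ≤ₚ j × i ≢ j

  _<ₚ?_ : ∀ i j → Dec (i <ₚ j)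
  i <ₚ? j = (i ≤? j) ×-dec ¬? (i Fin.≟ j)

record Occurrence {n m} (B : FerrersBoard n) (T : Filling B) (σ : Pattern m)
                  (r c : Vec (Fin n) m) : Set where
  field
    r-increasing : AllPairs _<_ r
    c-increasing : AllPairs _<_ c
    inside       : ∀ a b → InBoard B (lookup r a) (lookup c b)
    ones         : ∀ b → One {B = B} T (lookup r (σ ⟨$⟩ b)) (lookup c b)

Contains : ∀ {n m} (B : FerrersBoard n) → Filling B → Pattern m → Set
Contains B T α = ∃₂ λ r c → Occurrence B T α r c

LinearExtension : ∀ {m} → POP m → Pattern m → Set
LinearExtension p σ = ∀ j j′ → j <ₚ j′ → σ ⟨$⟩ j < σ ⟨$⟩ j′
  where open POP p

ContainsPOP : ∀ {n m} (B : FerrersBoard n) → Filling B → POP m → Set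
ContainsPOP {m = m} B T p = ∃ λ (σ : Pattern m) → LinearExtension p σ × Contains B T σ

AvoidsPOP : ∀ {n m} (B : FerrersBoard n) → POP m → Filling B → Set
AvoidsPOP B p T = ¬ ContainsPOP B T p

PatternSet : Set
PatternSet = List (∃ Pattern)

AvoidsAll : ∀ {n} (B : FerrersBoard n) → PatternSet → Filling B → Set
AvoidsAll B S T = ListAll.All (λ α → ¬ Contains B T (proj₂ α)) S

anyVec? : ∀ {n m} {P : Pred (Vec (Fin n) m) 0ℓ} → Decidable P → Dec (∃ P)
anyVec? {m = zero}  P? = map′ ([] ,_) (λ where ([] , p) → p) (P? [])
anyVec? {m = suc m} P? =
  map′ (λ where (x , xs , p) → x ∷ xs , p)
       (λ where (x ∷ xs , p) → x , xs , p)
       (any? λ x → anyVec? λ xs → P? (x ∷ xs))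

occurrence? : ∀ {n m} (B : FerrersBoard n) (T : Filling B) (σ : Pattern m) r c →
              Dec (Occurrence B T σ r c)
occurrence? B T σ r c =
  map′ (λ where (p , q , s , t) → record
                  { r-increasing = p ; c-increasing = q ; inside = s ; ones = t })
       (λ o → let open Occurrence o in r-increasing , c-increasing , inside , ones)
       (allPairs? Fin._<?_ r ×-dec allPairs? Fin._<?_ c ×-dec
        all? (λ a → all? λ b → inBoard? B (lookup r a) (lookup c b)) ×-dec
        all? (λ b → one? {B = B} T (lookup r (σ ⟨$⟩ b)) (lookup c b)))

contains? : ∀ {n m} (B : FerrersBoard n) (T : Filling B) (α : Pattern m) →
            Dec (Contains B T α)
contains? B T α = anyVec? λ r → anyVec? λ c → occurrence? B T α r c

linearExtension? : ∀ {m} (p : POP m) → Decidable (LinearExtension p)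
linearExtension? p σ =
  all? λ j → all? λ j′ → (j <ₚ? j′) →-dec (σ ⟨$⟩ j Fin.<? σ ⟨$⟩ j′)
  where open POP p

containsPOP? : ∀ {n m} (B : FerrersBoard n) (T : Filling B) (p : POP m) →
               Dec (ContainsPOP B T p)
containsPOP? {n} {m} B T p =
  map′ (λ where (w , u , q) → mkPattern w u , q)
       (λ where (mkPattern w u , q) → w , u , q)
       (anyVec? withWord?)
  where
  WithWord : Vec (Fin m) m → Set
  WithWord w = Σ (Unique w) λ u →
    LinearExtension p (mkPattern w u) × Contains B T (mkPattern w u)

  withWord? : Decidable WithWord
  withWord? w with unique? w
  ... | no ¬u = no λ where (u , _) → ¬u u
  ... | yes u = map′ (u ,_)
                     (λ where (_ , l , r , c , o) → l , r , c , record { Occurrence o })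
                     (linearExtension? p (mkPattern w u) ×-dec contains? B T (mkPattern w u))

avoidsPOP? : ∀ {n m} (B : FerrersBoard n) (p : POP m) → Decidable (AvoidsPOP B p)
avoidsPOP? B p T = ¬? (containsPOP? B T p)

avoidsAll? : ∀ {n} (B : FerrersBoard n) (S : PatternSet) → Decidable (AvoidsAll B S)
avoidsAll? B S T = ListAll.all? (λ α → ¬? (contains? B T (proj₂ α))) S

bits : List Bool
bits = true List.∷ false List.∷ List.[]

bitVectors : ∀ l → List (Vec Bool l)
bitVectors zero    = [] List.∷ List.[]
bitVectors (suc l) = cartesianProductWith _∷_ bits (bitVectors l)

allFillings : ∀ {n} (ls : Vec ℕ n) → List (All (Vec Bool) ls)
allFillings []       = [] List.∷ List.[]
allFillings (l ∷ ls) = cartesianProductWith _∷_ (bitVectors l) (allFillings ls)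

-- allFillings lists every filling exactly once, so that the length of a
-- filtered list is a cardinality.

∈-bits : ∀ b → b ∈ bits
∈-bits true  = here refl
∈-bits false = there (here refl)

bits-unique : ListUnique.Unique bits
bits-unique =
  ((λ ()) ListAll.∷ ListAll.[]) ListUnique.∷ ListAll.[] ListUnique.∷ ListUnique.[]

∈-bitVectors : ∀ {l} (v : Vec Bool l) → v ∈ bitVectors l
∈-bitVectors []      = here refl
∈-bitVectors (b ∷ v) = ∈-cartesianProductWith⁺ _∷_ (∈-bits b) (∈-bitVectors v)

bitVectors-unique : ∀ l → ListUnique.Unique (bitVectors l)
bitVectors-unique zero    = ListAll.[] ListUnique.∷ ListUnique.[]
bitVectors-unique (suc l) =
  cartesianProductWith⁺ _∷_ (λ where refl → refl , refl)
    bits-unique (bitVectors-unique l)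

∈-allFillings : ∀ {n} {ls : Vec ℕ n} (T : All (Vec Bool) ls) → T ∈ allFillings ls
∈-allFillings []      = here refl
∈-allFillings (v ∷ T) = ∈-cartesianProductWith⁺ _∷_ (∈-bitVectors v) (∈-allFillings T)

allFillings-unique : ∀ {n} (ls : Vec ℕ n) → ListUnique.Unique (allFillings ls)
allFillings-unique []       = ListAll.[] ListUnique.∷ ListUnique.[]
allFillings-unique (l ∷ ls) =
  cartesianProductWith⁺ _∷_ (λ where refl → refl , refl)
    (bitVectors-unique l) (allFillings-unique ls)

#transversals : ∀ {n} (B : FerrersBoard n) {P : Pred (Filling B) 0ℓ} → Decidable P → ℕ
#transversals B P? =
  length (filter (λ T → isTransversal? {B = B} T ×-dec P? T) (allFillings (rows B)))

infix 4 _∼ₛ_ _≈ₛ_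

_∼ₛ_ : ∀ {m m′} → POP m → POP m′ → Set
p ∼ₛ q = ∀ {n} (B : FerrersBoard n) →
  #transversals B (avoidsPOP? B p) ≡ #transversals B (avoidsPOP? B q)

_≈ₛ_ : PatternSet → PatternSet → Set
S ≈ₛ S′ = ∀ {n} (B : FerrersBoard n) →
  #transversals B (avoidsAll? B S) ≡ #transversals B (avoidsAll? B S′)

singleRelation : ∀ {m} (a b : Fin m) → a ≢ b → POP m
singleRelation {m} a b a≢b = record
  { _≤ₚ_              = _≤_
  ; isDecPartialOrder = record
    { isPartialOrder = record
      { isPreorder = record
        { isEquivalence = isEquivalence
        ; reflexive     = inj₁
        ; trans         = trans
        }
      ; antisym = antisym
      }
    ; _≟_  = Fin._≟_
    ; _≤?_ = λ i j → (i Fin.≟ j) ⊎-dec ((i Fin.≟ a) ×-dec (j Fin.≟ b))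
    }
  }
  where
  _≤_ : Rel (Fin m) 0ℓ
  i ≤ j = i ≡ j ⊎ (i ≡ a × j ≡ b)

  trans : ∀ {i j k} → i ≤ j → j ≤ k → i ≤ k
  trans (inj₁ refl)          j≤k                  = j≤k
  trans i≤j                  (inj₁ refl)          = i≤j
  trans (inj₂ (_ , refl))    (inj₂ (refl , _))    = contradiction refl a≢b

  antisym : ∀ {i j} → i ≤ j → j ≤ i → i ≡ j
  antisym (inj₁ i≡j)         _                    = i≡j
  antisym _                  (inj₁ j≡i)           = sym j≡i
  antisym (inj₂ (_ , refl))  (inj₂ (refl , _))    = contradiction refl a≢b

-- Elements and letters 1, 2, 3 are 0F, 1F, 2F.

p : POP 3
p = singleRelation 2F 1F λ ()

p′ : POP 3
p′ = singleRelation 1F 2F λ ()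

perm : ∀ {m} (w : Vec (Fin m) m) {_ : True (unique? w)} → ∃ Pattern
perm {m} w {u} = m , mkPattern w (toWitness u)

pattern132 pattern231 pattern321 pattern123 pattern213 pattern312 : ∃ Pattern
pattern132 = perm (0F ∷ 2F ∷ 1F ∷ [])
pattern231 = perm (1F ∷ 2F ∷ 0F ∷ [])
pattern321 = perm (2F ∷ 1F ∷ 0F ∷ [])
pattern123 = perm (0F ∷ 1F ∷ 2F ∷ [])
pattern213 = perm (1F ∷ 0F ∷ 2F ∷ [])
pattern312 = perm (2F ∷ 0F ∷ 1F ∷ [])

{-# OPTIONS --safe #-}

-- Say that a column sees an earlier column when the one of the latter lies
-- within the height of the former. A transversal avoids p (resp. p′) iff the
-- row of every column is above (resp. below) the rows of all the columns it
-- sees, the leftmost of these excepted. The last column, of height m + 1,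
-- sees all the rows 0, …, m but its own. Deleting this column and its row
-- leaves an arbitrary avoider T of the smaller board, and the deleted row was
--   for p:  m, or m - 1 if the leftmost one of T in rows below m is in row m - 1;
--   for p′: 0, or 1 if that leftmost one is in row 0.
-- So it suffices that equally many p-avoiders have their leftmost one below
-- row j in row j - 1 as p′-avoiders have it in row 0. For j = 1 both count
-- all avoiders. For 2 ≤ j ≤ m + 1, the same deletion shows that both numbers
-- equal the number for the smaller board with j = m; for p this uses that a
-- p-avoider cannot have row j - 1 leading below j and row m - 1 leading below
-- m for 2 ≤ j < m, as these two rows and row 0 would be an occurrence of p.

module Submission where

open import Defs
open import Data.Bool.Base using (Bool; true; false)
open import Data.Fin.Base as Fin using (Fin; zero; suc; toℕ; fromℕ<; inject≤; opposite)
open import Data.Fin.Patterns using (0F; 1F; 2F)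
import Data.Fin.Properties as Fin
open import Data.List.Base as List using (List; []; _∷_; _++_; length; filter)
open import Data.List.Properties using (length-++; length-map; filter-++; filter-all; filter-none)
open import Data.List.Membership.Propositional using (_∈_)
open import Data.List.Membership.Propositional.Properties using (∈-lookup; ∈-map⁺; ∈-map⁻; ∈-++⁺ˡ; ∈-++⁺ʳ; ∈-++⁻; ∈-filter⁺; ∈-filter⁻)
open import Data.List.Relation.Unary.All as All using ([]; _∷_)
open import Data.List.Relation.Unary.AllPairs using ([]; _∷_)
open import Data.List.Relation.Unary.Any using (here; there; index)
open import Data.List.Relation.Unary.Any.Properties using (lookup-index)
open import Data.List.Relation.Unary.Unique.Propositional using (Unique)
import Data.List.Relation.Unary.Unique.Propositional.Properties as Unique
open import Data.Nat.Base using (ℕ; zero; suc; 2+; pred; _+_; _≤_; _<_; _≥_; _>_; z≤n; s≤s; z<s; s<s; >-nonZero)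
open import Data.Nat.Properties
open import Data.Product.Base using (∃; _×_; _,_; proj₁; proj₂)
open import Data.Sum.Base as Sum using (_⊎_; inj₁; inj₂)
open import Data.Vec.Base as Vec using (Vec; []; _∷_) renaming (lookup to infixl 8 _!_)
open import Data.Vec.Properties using (lookup-map; lookup∘tabulate; ∷-injectiveˡ; ∷-injectiveʳ; map-∘; map-cong; map-id)
open import Data.Vec.Relation.Unary.All as VecAll using ([]; _∷_)
open import Data.Vec.Relation.Unary.All.Properties using (lookup⁺; lookup⁻)
open import Data.Vec.Relation.Unary.AllPairs using (AllPairs; []; _∷_)
open import Function.Base using (_∘_)
open import Level using (0ℓ)
open import Relation.Binary.Core using (Rel)
open import Relation.Binary.Definitions using (tri<; tri≈; tri>)
open import Relation.Binary.PropositionalEquality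
open import Relation.Nullary using (¬_; Dec; yes; no; does; contradiction; _×-dec_; _→-dec_)
open import Relation.Nullary.Decidable using (map′; dec-true; from-yes)
open import Relation.Unary using (Pred; Decidable)

private variable
  n m k j r x y : ℕ
  A C : Set

-- Counting

unique-lookup-injective : {xs : List A} → Unique xs →
  ∀ {i j} → List.lookup xs i ≡ List.lookup xs j → i ≡ j
unique-lookup-injective (_ ∷ _)    {zero}  {zero}  _  = refl
unique-lookup-injective (x∉ ∷ _)   {zero}  {suc j} eq = contradiction eq (All.lookup x∉ (∈-lookup j))
unique-lookup-injective (x∉ ∷ _)   {suc i} {zero}  eq = contradiction (sym eq) (All.lookup x∉ (∈-lookup i))
unique-lookup-injective (_ ∷ uniq) {suc i} {suc j} eq = cong suc (unique-lookup-injective uniq eq)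

-- Stated for a relation, so that one relation between fillings and words can be counted in both
-- directions. Sending the position of `x` to that of a partner is injective: equal positions carry
-- equal partners, hence equal elements, and `xs` has no repetitions.
matching⇒length-≤ : {xs : List A} {ys : List C} (_~_ : A → C → Set) → Unique xs →
  (∀ {x} → x ∈ xs → ∃ λ y → y ∈ ys × x ~ y) →
  (∀ {x x′ y} → x ∈ xs → x′ ∈ xs → x ~ y → x′ ~ y → x ≡ x′) →
  length xs ≤ length ys
matching⇒length-≤ {xs = xs} {ys} _~_ uniq match inj =
  Fin.injective⇒≤ {f = λ i → index (y∈ i)} λ {i} {j} eq →
    unique-lookup-injective uniq
      (inj (∈-lookup i) (∈-lookup j) (rel i)
        (subst (List.lookup xs j ~_) (sym (y-cong eq)) (rel j)))
  where
  y∈  = λ i → proj₁ (proj₂ (match (∈-lookup {xs = xs} i)))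
  rel = λ i → proj₂ (proj₂ (match (∈-lookup {xs = xs} i)))

  y-cong : ∀ {i j} → index (y∈ i) ≡ index (y∈ j) →
           proj₁ (match (∈-lookup i)) ≡ proj₁ (match (∈-lookup j))
  y-cong {i} {j} eq = trans (lookup-index (y∈ i))
    (trans (cong (List.lookup ys) eq) (sym (lookup-index (y∈ j))))

module _ {P : Pred A 0ℓ} (P? : Decidable P) where

  length-filter-++ : ∀ xs ys → length (filter P? (xs ++ ys)) ≡ length (filter P? xs) + length (filter P? ys)
  length-filter-++ xs ys = trans (cong length (filter-++ P? xs ys)) (length-++ (filter P? xs))

  length-filter-all : ∀ {xs} → (∀ {x} → x ∈ xs → P x) → length (filter P? xs) ≡ length xs
  length-filter-all all = cong length (filter-all P? (All.tabulate all))

  length-filter-none : ∀ {xs} → (∀ {x} → x ∈ xs → ¬ P x) → length (filter P? xs) ≡ 0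
  length-filter-none none = cong length (filter-none P? (All.tabulate none))

length-filter-map : {P : Pred C 0ℓ} (P? : Decidable P) {Q : Pred A 0ℓ} (Q? : Decidable Q) (f : A → C) → ∀ xs →
  (∀ {x} → x ∈ xs → P (f x) → Q x) → (∀ {x} → x ∈ xs → Q x → P (f x)) →
  length (filter P? (List.map f xs)) ≡ length (filter Q? xs)
length-filter-map P? Q? f []       to from = refl
length-filter-map P? Q? f (x ∷ xs) to from
  with ih ← length-filter-map P? Q? f xs (to ∘ there) (from ∘ there) | P? (f x) | Q? x
... | yes p | yes q = cong suc ih
... | yes p | no ¬q = contradiction (to (here refl) p) ¬q
... | no ¬p | yes q = contradiction (from (here refl) q) ¬p
... | no ¬p | no ¬q = ih

-- Inserting a row

-- `punch k` is the order embedding of the natural numbers onto the complement of `k`. `unpunch k`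
-- inverts it there; its value at `k` itself is a mere default.
punch unpunch : ℕ → ℕ → ℕ
punch zero    x       = suc x
punch (suc k) zero    = zero
punch (suc k) (suc x) = suc (punch k x)

unpunch zero    x       = pred x
unpunch (suc k) zero    = zero
unpunch (suc k) (suc x) = suc (unpunch k x)

punch-≢ : ∀ k x → punch k x ≢ k
punch-≢ (suc k) (suc x) eq = punch-≢ k x (suc-injective eq)

unpunch-punch : ∀ k x → unpunch k (punch k x) ≡ x
unpunch-punch zero    x       = refl
unpunch-punch (suc k) zero    = refl
unpunch-punch (suc k) (suc x) = cong suc (unpunch-punch k x)

punch-unpunch : ∀ k x → x ≢ k → punch k (unpunch k x) ≡ x
punch-unpunch zero    zero    x≢k = contradiction refl x≢k
punch-unpunch zero    (suc x) x≢k = refl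
punch-unpunch (suc k) zero    x≢k = refl
punch-unpunch (suc k) (suc x) x≢k = cong suc (punch-unpunch k x (x≢k ∘ cong suc))

punch-injective : ∀ k → punch k x ≡ punch k y → x ≡ y
punch-injective {x} {y} k eq =
  trans (sym (unpunch-punch k x)) (trans (cong (unpunch k) eq) (unpunch-punch k y))

punch-mono-< : ∀ k → x < y → punch k x < punch k y
punch-mono-<                 zero    x<y       = s<s x<y
punch-mono-< {zero}  {suc y} (suc k) x<y       = z<s
punch-mono-< {suc x} {suc y} (suc k) (s<s x<y) = s<s (punch-mono-< k x<y)

punch-cancel-< : ∀ k → punch k x < punch k y → x < y
punch-cancel-< {x} {y} k lt with <-cmp x y
... | tri< x<y _ _  = x<y
... | tri≈ _ refl _ = contradiction lt (<-irrefl refl)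
... | tri> _ _ y<x  = contradiction lt (<-asym (punch-mono-< k y<x))

punch-≥ : k ≤ x → punch k x ≡ suc x
punch-≥ {zero}          k≤x       = refl
punch-≥ {suc k} {suc x} (s≤s k≤x) = cong suc (punch-≥ k≤x)

punch-< : x < k → punch k x ≡ x
punch-< {zero}  {suc k} x<k       = refl
punch-< {suc x} {suc k} (s<s x<k) = cong suc (punch-< x<k)

-- A new row `k ≤ j` turns a column of height `j` into one of height `suc j`; with the converse
-- below, an old row lies in the old column iff its shifted copy lies in the new one.
punch-<-suc⁺ : k ≤ j → x < j → punch k x < suc j
punch-<-suc⁺ {k} {j} {x} k≤j x<j = subst (punch k x <_) (punch-≥ k≤j) (punch-mono-< k x<j)

punch-<-suc⁻ : k ≤ j → punch k x < suc j → x < j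
punch-<-suc⁻ {k} {j} {x} k≤j lt = punch-cancel-< k (subst (punch k x <_) (sym (punch-≥ k≤j)) lt)

x≤punch : ∀ k x → x ≤ punch k x
x≤punch zero    x       = n≤1+n x
x≤punch (suc k) zero    = z≤n
x≤punch (suc k) (suc x) = s≤s (x≤punch k x)

-- Adds a last column, the head of the word, together with a new row `k` that holds its one.
insert : ℕ → Vec ℕ n → Vec ℕ (suc n)
insert k w = k ∷ Vec.map (punch k) w

insert-injective : ∀ k {w w′ : Vec ℕ n} → insert k w ≡ insert k w′ → w ≡ w′
insert-injective k {w} {w′} eq =
  trans (sym (unmap w)) (trans (cong (Vec.map (unpunch k)) (∷-injectiveʳ eq)) (unmap w′))
  where
  unmap : ∀ u → Vec.map (unpunch k) (Vec.map (punch k) u) ≡ u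
  unmap u = trans (sym (map-∘ _ _ u)) (trans (map-cong (unpunch-punch k) u) (map-id u))

lookup-ext : {u v : Vec A n} → (∀ i → u ! i ≡ v ! i) → u ≡ v
lookup-ext {u = []}    {[]}    _  = refl
lookup-ext {u = _ ∷ _} {_ ∷ _} eq = cong₂ _∷_ (eq zero) (lookup-ext (eq ∘ suc))

-- Transversals as words

-- A transversal is the word of the rows of its ones, read from the last
-- column to the first, and a board is the word of its column heights in
-- the same order.

record IsPermutation (v : Vec ℕ n) : Set where
  field
    injective  : ∀ {i j} → v ! i ≡ v ! j → i ≡ j
    surjective : ∀ {r} → r < n → ∃ λ i → v ! i ≡ r

-- Among the ones in rows below j, the leftmost lies in row r; leftmost is
-- last, as words are read from right to left.
record Leads (j r : ℕ) (v : Vec ℕ n) : Set where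
  constructor leader
  field
    pos   : Fin n
    at    : v ! pos ≡ r
    below : r < j
    last  : ∀ i → pos Fin.< i → j ≤ v ! i

leads? : ∀ j r → Decidable (Leads {n} j r)
leads? j r v = map′ (λ (i , eq , r<j , last) → leader i eq r<j last)
                    (λ (leader i eq r<j last) → i , eq , r<j , last)
  (Fin.any? λ i → (v ! i ≟ r) ×-dec (r <? j) ×-dec
    Fin.all? λ i′ → (i Fin.<? i′) →-dec (j ≤? v ! i′))

module _ {w : Vec ℕ n} where

  leads-∷⁺ : Leads j r w → Leads j r (x ∷ w)
  leads-∷⁺ (leader i eq r<j late) = leader (suc i) eq r<j λ where
    (suc i′) (s<s i<i′) → late i′ i<i′

  leads-∷⁻ : r ≢ x → Leads j r (x ∷ w) → Leads j r w
  leads-∷⁻ r≢x (leader zero    eq r<j late) = contradiction (sym eq) r≢x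
  leads-∷⁻ r≢x (leader (suc i) eq r<j late) = leader i eq r<j λ i′ i<i′ → late (suc i′) (s<s i<i′)

  leads-anti : j ≤ k → r < j → Leads k r w → Leads j r w
  leads-anti j≤k r<j (leader i eq _ late) = leader i eq r<j λ i′ i<i′ → ≤-trans j≤k (late i′ i<i′)

  leads-punch : k ≤ j → Leads j r w → Leads (suc j) (punch k r) (Vec.map (punch k) w)
  leads-punch {k} {j} k≤j (leader i refl r<j late) =
    leader i (lookup-map i (punch k) w) (punch-<-suc⁺ k≤j r<j) λ i′ i<i′ →
      ≮⇒≥ λ lt → <⇒≱ (punch-<-suc⁻ k≤j (subst (_< suc j) (lookup-map i′ (punch k) w) lt)) (late i′ i<i′)

  leads-punch-low⁺ : j ≤ k → Leads j r w → Leads j r (Vec.map (punch k) w)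
  leads-punch-low⁺ {j} {k} j≤k (leader i refl r<j late) =
    leader i (trans (lookup-map i (punch k) w) (punch-< (<-≤-trans r<j j≤k))) r<j λ i′ i<i′ →
      subst (j ≤_) (sym (lookup-map i′ (punch k) w)) (≤-trans (late i′ i<i′) (x≤punch k _))

  leads-punch-low⁻ : j ≤ k → Leads j r (Vec.map (punch k) w) → Leads j r w
  leads-punch-low⁻ {j} {k} {r} j≤k (leader i eq r<j late) = leader i
    (punch-injective k (trans (trans (sym (lookup-map i (punch k) w)) eq) (sym (punch-< (<-≤-trans r<j j≤k))))) r<j
    λ i′ i<i′ → ≮⇒≥ λ lt → <⇒≱
      (subst (_< j) (sym (trans (lookup-map i′ (punch k) w) (punch-< (<-≤-trans lt j≤k)))) lt) (late i′ i<i′)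

  -- The head is the rightmost column, so it fails to lead as soon as any old one ends up below `j`.
  ¬leads-head : ∀ i → punch k (w ! i) < j → ¬ Leads j k (insert k w)
  ¬leads-head {k} {j} i lt (leader zero _ _ late) =
    <⇒≱ lt (subst (j ≤_) (lookup-map i (punch k) w) (late (suc i) z<s))
  ¬leads-head {k} i lt (leader (suc i′) eq _ _) =
    punch-≢ k (w ! i′) (trans (sym (lookup-map i′ (punch k) w)) eq)

leads-unique : ∀ {w : Vec ℕ n} → Leads j x w → Leads j y w → x ≡ y
leads-unique (leader i refl x<j late) (leader i′ refl y<j late′) with Fin.<-cmp i i′
... | tri< i<i′ _ _ = contradiction (late i′ i<i′) (<⇒≱ y<j)
... | tri≈ _ refl _ = refl
... | tri> _ _ i′<i = contradiction (late′ i i′<i) (<⇒≱ x<j)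

leader-last : ∀ {w : Vec ℕ n} {a b} → IsPermutation w → Leads j r w → b Fin.< a → w ! a < j → w ! b ≢ r
leader-last perm (leader i eq _ late) b<a wa<j wb≡r
  with refl ← IsPermutation.injective perm (trans wb≡r (sym eq)) = <⇒≱ wa<j (late _ b<a)

-- Indices grow leftwards: `c` is the column that sees the other two, and `a` witnesses that `b` is
-- not the leftmost column seen.
Avoids : Rel ℕ 0ℓ → Vec ℕ n → Vec ℕ n → Set
Avoids R hs v = ∀ {c b a} → c Fin.< b → b Fin.< a →
  v ! b < hs ! c → v ! a < hs ! c → R (v ! b) (v ! c)

-- The condition that Avoids puts on the head k of insert k w, when its
-- column has height suc m.
HeadAvoids : Rel ℕ 0ℓ → ℕ → ℕ → Vec ℕ n → Set
HeadAvoids R m k w = ∀ {b a} → b Fin.< a → w ! b < m → w ! a < m → R (punch k (w ! b)) k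

-- A row `x < m` violating the comparison with `k` can only be the exempt leftmost one. The bound
-- `m ≤ n` ensures that row `x` occurs at all.
headAvoids⇒leads : ∀ R {w : Vec ℕ n} → IsPermutation w → m ≤ n → HeadAvoids R m k w →
  x < m → ¬ R (punch k x) k → Leads m x w
headAvoids⇒leads R perm m≤n head x<m ¬R
  with i , refl ← IsPermutation.surjective perm (<-≤-trans x<m m≤n) =
  leader i refl x<m λ i′ i<i′ → ≮⇒≥ λ lt → ¬R (head i<i′ x<m lt)

-- Avoiders and the deletion of the last column

record IsAvoider (R : Rel ℕ 0ℓ) (hs v : Vec ℕ n) : Set where
  field
    permutation : IsPermutation v
    fits        : ∀ i → v ! i < hs ! i
    avoids      : Avoids R hs v
  open IsPermutation permutation public

record IsHeights (hs : Vec ℕ n) : Set where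
  field
    bounded : ∀ i → hs ! i ≤ n
    sorted  : ∀ {i j} → i Fin.≤ j → hs ! i ≤ hs ! j

open IsAvoider
open IsHeights

isHeights-tail : ∀ {hs : Vec ℕ n} → IsHeights (x ∷ hs) → IsHeights (Vec.map pred hs)
isHeights-tail {hs = hs} H .bounded i rewrite lookup-map i pred hs = pred-mono-≤ (bounded H (suc i))
isHeights-tail {hs = hs} H .sorted {i} {j} i≤j
  rewrite lookup-map i pred hs | lookup-map j pred hs = pred-mono-≤ (sorted H (s≤s i≤j))

-- The remaining columns are at least as high as the last one, of height `suc m`, so row `k` meets
-- all of them and `pred` is a genuine subtraction.
module Lowered {hs : Vec ℕ n} (H : IsHeights (suc m ∷ hs)) (k≤m : k ≤ m) where

  suc-lowered : ∀ i → suc (Vec.map pred hs ! i) ≡ hs ! i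
  suc-lowered i rewrite lookup-map i pred hs with hs ! i | sorted H {zero} {suc i} z≤n
  ... | suc _ | _ = refl

  k≤ : ∀ i → k ≤ Vec.map pred hs ! i
  k≤ i = ≤-pred (≤-trans (s≤s k≤m) (subst (suc m ≤_) (sym (suc-lowered i)) (sorted H {zero} {suc i} z≤n)))

-- What `p` and `p′` have in common, so that the recursion and the passage to boards are done once.
-- `R` is demanded between the row of a seen column, not the leftmost, and the row of the column
-- seeing it.
record Rule : Set₁ where
  field
    R              : Rel ℕ 0ℓ
    R-asym         : R x y → ¬ R y x
    R-connex       : x ≢ y → R x y ⊎ R y x
    R-punch⁺       : ∀ k → R x y → R (punch k x) (punch k y)
    R-punch⁻       : ∀ k → R (punch k x) (punch k y) → R x y
    -- The rows available to a last column of height suc m: one that is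
    -- always allowed, and one that is allowed just when the given row
    -- leads among the other rows of that column.
    free tied lead : ℕ → ℕ
    free≢tied      : 0 < m → free m ≢ tied m
    free≤          : ∀ m → free m ≤ m
    tied≤          : 0 < m → tied m ≤ m
    free-avoids    : {w : Vec ℕ n} → HeadAvoids R m (free m) w
    tied-avoids    : {w : Vec ℕ n} → IsPermutation w → Leads m (lead m) w → HeadAvoids R m (tied m) w
    head-cases     : {w : Vec ℕ n} → IsPermutation w → m ≤ n → k ≤ m → HeadAvoids R m k w →
                     k ≡ free m ⊎ k ≡ tied m × Leads m (lead m) w

module _ (ρ : Rule) where
  open Rule ρ

  -- `punch k` preserves `R` and which columns see which, so triples in the tail come from `w`;
  -- triples starting at the head are governed by `HeadAvoids`.
  isAvoider-insert : ∀ {hs w : Vec ℕ n} → IsHeights (suc m ∷ hs) → k ≤ m → HeadAvoids R m k w →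
    IsAvoider R (Vec.map pred hs) w → IsAvoider R (suc m ∷ hs) (insert k w)
  isAvoider-insert {n} {m} {k} {hs} {w} H k≤m head W = record
    { permutation = record { injective = inj ; surjective = surj }
    ; fits   = λ where
        zero    → s≤s k≤m
        (suc i) → fit i
    ; avoids = av
    }
    where
    w′ = Vec.map (punch k) w

    look : ∀ i → w′ ! i ≡ punch k (w ! i)
    look i = lookup-map i (punch k) w

    open Lowered H k≤m

    inj : ∀ {i j} → insert k w ! i ≡ insert k w ! j → i ≡ j
    inj {zero}  {zero}  _  = refl
    inj {zero}  {suc j} eq = contradiction (trans (sym (look j)) (sym eq)) (punch-≢ k _)
    inj {suc i} {zero}  eq = contradiction (trans (sym (look i)) eq) (punch-≢ k _)
    inj {suc i} {suc j} eq =
      cong suc (injective W (punch-injective k (trans (sym (look i)) (trans eq (look j)))))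

    surj : ∀ {r} → r < suc n → ∃ λ i → insert k w ! i ≡ r
    surj {r} r<1+n with r ≟ k
    ... | yes refl = zero , refl
    ... | no r≢k =
      let i , eq = surjective W {unpunch k r}
                     (punch-<-suc⁻ (≤-trans k≤m (≤-pred (bounded H zero)))
                       (subst (_< suc n) (sym (punch-unpunch k r r≢k)) r<1+n))
      in suc i , trans (look i) (trans (cong (punch k) eq) (punch-unpunch k r r≢k))

    fit : ∀ i → w′ ! i < hs ! i
    fit i = subst₂ _<_ (sym (look i)) (suc-lowered i) (punch-<-suc⁺ (k≤ i) (fits W i))

    lower : ∀ c b → w′ ! b < hs ! c → w ! b < Vec.map pred hs ! c
    lower c b lt = punch-<-suc⁻ (k≤ c) (subst₂ _<_ (look b) (sym (suc-lowered c)) lt)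

    av : Avoids R (suc m ∷ hs) (insert k w)
    av {zero}  {suc b} {suc a} c<b (s<s b<a) vb va = subst (λ z → R z k) (sym (look b))
      (head b<a (punch-<-suc⁻ k≤m (subst (_< suc m) (look b) vb))
                (punch-<-suc⁻ k≤m (subst (_< suc m) (look a) va)))
    av {suc c} {suc b} {suc a} (s<s c<b) (s<s b<a) vb va =
      subst₂ R (sym (look b)) (sym (look c))
        (R-punch⁺ k (avoids W c<b b<a (lower c b vb) (lower c a va)))

  -- By injectivity no other column has its one in row `k`, so `unpunch k` loses nothing and the
  -- insertion can be reversed.
  isAvoider-uncons : ∀ {hs w : Vec ℕ n} → IsHeights (suc m ∷ hs) → IsAvoider R (suc m ∷ hs) (k ∷ w) →
    ∃ λ w′ → k ∷ w ≡ insert k w′ × k ≤ m × HeadAvoids R m k w′ × IsAvoider R (Vec.map pred hs) w′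
  isAvoider-uncons {n} {m} {k} {hs} {w} H V = w′ , cong (k ∷_) w≡ , k≤m , head , record
    { permutation = record
        { injective  = λ {i} {j} eq → Fin.suc-injective
            (injective V (trans (look i) (trans (cong (punch k) eq) (sym (look j)))))
        ; surjective = surj
        }
    ; fits   = λ i → lower i i (fits V (suc i))
    ; avoids = λ {c} {b} {a} c<b b<a vb va → R-punch⁻ k (subst₂ R (look b) (look c)
        (avoids V (s<s c<b) (s<s b<a) (raise c b vb) (raise c a va)))
    }
    where
    w′ = Vec.map (unpunch k) w

    k≤m : k ≤ m
    k≤m = ≤-pred (fits V zero)

    w!≢k : ∀ i → w ! i ≢ k
    w!≢k i eq with () ← injective V {suc i} {zero} eq

    look : ∀ i → w ! i ≡ punch k (w′ ! i)
    look i = sym (trans (cong (punch k) (lookup-map i (unpunch k) w)) (punch-unpunch k _ (w!≢k i)))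

    w≡ : w ≡ Vec.map (punch k) w′
    w≡ = lookup-ext λ i → trans (look i) (sym (lookup-map i (punch k) w′))

    open Lowered H k≤m

    raise : ∀ c b → w′ ! b < Vec.map pred hs ! c → w ! b < hs ! c
    raise c b lt = subst₂ _<_ (sym (look b)) (suc-lowered c) (punch-<-suc⁺ (k≤ c) lt)

    lower : ∀ c b → w ! b < hs ! c → w′ ! b < Vec.map pred hs ! c
    lower c b lt = punch-<-suc⁻ (k≤ c) (subst₂ _<_ (look b) (sym (suc-lowered c)) lt)

    head : HeadAvoids R m k w′
    head {b} {a} b<a vb va = subst (λ z → R z k) (look b) (avoids V {zero} z<s (s<s b<a)
      (subst (_< suc m) (sym (look b)) (punch-<-suc⁺ k≤m vb))
      (subst (_< suc m) (sym (look a)) (punch-<-suc⁺ k≤m va)))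

    surj : ∀ {r} → r < n → ∃ λ i → w′ ! i ≡ r
    surj {r} r<n with surjective V {punch k r} (punch-<-suc⁺ (≤-trans k≤m (≤-pred (bounded H zero))) r<n)
    ... | zero  , eq = contradiction (sym eq) (punch-≢ k r)
    ... | suc i , eq = i , punch-injective k (trans (sym (look i)) eq)

  -- Every avoider arises exactly once from the avoider left after deleting its last column. A last
  -- column of height 0 has no room for a one, hence the empty list.
  avoiders : Vec ℕ n → List (Vec ℕ n)
  avoiders {zero}  []           = [] ∷ []
  avoiders {suc n} (zero ∷ hs)  = []
  avoiders {suc n} (suc m ∷ hs) =
    List.map (insert (free m)) V ++ List.map (insert (tied m)) (filter (leads? m (lead m)) V)
    where V = avoiders (Vec.map pred hs)

  avoiders-unique : ∀ {n} (hs : Vec ℕ n) → Unique (avoiders hs)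
  avoiders-unique {zero}  []           = All.[] ∷ []
  avoiders-unique {suc n} (zero ∷ hs)  = []
  avoiders-unique {suc n} (suc m ∷ hs) = Unique.++⁺
    (Unique.map⁺ (insert-injective _) uniq)
    (Unique.map⁺ (insert-injective _) (Unique.filter⁺ (leads? m (lead m)) uniq))
    λ (v∈free , v∈tied) →
      let _ , _ , eq  = ∈-map⁻ _ v∈free
          _ , w∈ , eq′ = ∈-map⁻ _ v∈tied
          leader _ _ r<m _ = proj₂ (∈-filter⁻ (leads? m (lead m)) {xs = avoiders (Vec.map pred hs)} w∈)
      -- A leader below `m` yields `0 < m`, which excludes the case where both rows may coincide.
      in free≢tied (≤-<-trans z≤n r<m) (∷-injectiveˡ (trans (sym eq) eq′))
    where uniq = avoiders-unique (Vec.map pred hs)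

  ∈-avoiders⁻ : ∀ {n} {hs v : Vec ℕ n} → IsHeights hs → v ∈ avoiders hs → IsAvoider R hs v
  ∈-avoiders⁻ {zero}  {[]} {[]} H v∈ = record
    { permutation = record { injective = λ { {()} } ; surjective = λ () }
    ; fits = λ () ; avoids = λ { {()} } }
  ∈-avoiders⁻ {suc n} {suc m ∷ hs} H v∈ with ∈-++⁻ (List.map (insert (free m)) (avoiders (Vec.map pred hs))) v∈
  ... | inj₁ v∈ with w , w∈ , refl ← ∈-map⁻ _ v∈ =
    isAvoider-insert H (free≤ m) (free-avoids {w = w}) (∈-avoiders⁻ (isHeights-tail H) w∈)
  ... | inj₂ v∈ with w , w∈ , refl ← ∈-map⁻ _ v∈
                with w∈V , leads@(leader _ _ r<m _) ← ∈-filter⁻ (leads? m (lead m)) {xs = avoiders (Vec.map pred hs)} w∈ =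
    let W = ∈-avoiders⁻ (isHeights-tail H) w∈V
    in isAvoider-insert H (tied≤ (≤-<-trans z≤n r<m)) (tied-avoids (permutation W) leads) W

  ∈-avoiders⁺ : ∀ {n} {hs v : Vec ℕ n} → IsHeights hs → IsAvoider R hs v → v ∈ avoiders hs
  ∈-avoiders⁺ {zero}  {[]}         {[]}    H V = here refl
  ∈-avoiders⁺ {suc n} {zero ∷ hs}  {k ∷ w} H V with () ← fits V zero
  ∈-avoiders⁺ {suc n} {suc m ∷ hs} {k ∷ w} H V
    with w′ , eq , k≤m , head , W ← isAvoider-uncons H V
    with w′∈ ← ∈-avoiders⁺ (isHeights-tail H) W
    rewrite eq
    with head-cases (permutation W) (≤-pred (bounded H zero)) k≤m head
  ... | inj₁ refl           = ∈-++⁺ˡ (∈-map⁺ _ w′∈)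
  ... | inj₂ (refl , leads) = ∈-++⁺ʳ (List.map (insert (free m)) _)
                                (∈-map⁺ _ (∈-filter⁺ (leads? m (lead m)) w′∈ leads))

-- The rules for `p` and `p′`

≢⇒<⊎> : x ≢ y → x < y ⊎ x > y
≢⇒<⊎> {x} {y} x≢y with <-cmp x y
... | tri< x<y _ _ = inj₁ x<y
... | tri≈ _ x≡y _ = contradiction x≡y x≢y
... | tri> _ _ x>y = inj₂ x>y

p-rule : Rule
p-rule = record
  { R           = _<_
  ; R-asym      = <-asym
  ; R-connex    = ≢⇒<⊎>
  ; R-punch⁺    = punch-mono-<
  ; R-punch⁻    = punch-cancel-<
  ; free        = λ m → m
  ; tied        = pred
  ; lead        = pred
  ; free≢tied   = λ 0<m → <⇒≢ (pred< 0<m) ∘ sym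
  ; free≤       = λ _ → ≤-refl
  ; tied≤       = λ _ → pred[n]≤n
  ; free-avoids = λ {n} {m} _ wb<m _ → subst (_< m) (sym (punch-< wb<m)) wb<m
  ; tied-avoids = tied-avoids
  ; head-cases  = head-cases
  }
  where
  pred< : 0 < m → pred m < m
  pred< (s≤s _) = ≤-refl

  tied-avoids : {w : Vec ℕ n} → IsPermutation w → Leads m (pred m) w → HeadAvoids _<_ m (pred m) w
  tied-avoids {m = zero}  perm leads b<a () _
  -- The leader occupies row `m`, so the row at `b`, which is not leftmost, is below `m` and
  -- `punch m` fixes it.
  tied-avoids {m = suc m} perm leads b<a wb wa = subst (_< m) (sym (punch-< wb<m)) wb<m
    where wb<m = ≤∧≢⇒< (≤-pred wb) (leader-last perm leads b<a wa)

  head-cases : {w : Vec ℕ n} → IsPermutation w → m ≤ n → k ≤ m → HeadAvoids _<_ m k w →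
               k ≡ m ⊎ k ≡ pred m × Leads m (pred m) w
  head-cases {m = m} {k = k} {w = w} perm m≤n k≤m head with m≤n⇒m<n∨m≡n k≤m
  ... | inj₂ k≡m            = inj₁ k≡m
  -- Rows `k` and `pred m` of `w` both fail the comparison, so both lead below `m`; leaders being
  -- unique, they coincide.
  ... | inj₁ k<m@(s≤s k≤m′) = inj₂ (leads-unique {w = w} (leads k<m ≤-refl) top , top)
    where
    leads : x < m → k ≤ x → Leads m x w
    leads x<m k≤x = headAvoids⇒leads _<_ {w = w} perm m≤n head x<m
      λ lt → <⇒≱ (subst (_< k) (punch-≥ k≤x) lt) (m≤n⇒m≤1+n k≤x)
    top = leads ≤-refl k≤m′

p′-rule : Rule
p′-rule = record
  { R           = _>_
  ; R-asym      = <-asym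
  ; R-connex    = Sum.swap ∘ ≢⇒<⊎>
  ; R-punch⁺    = punch-mono-<
  ; R-punch⁻    = punch-cancel-<
  ; free        = λ _ → 0
  ; tied        = λ _ → 1
  ; lead        = λ _ → 0
  ; free≢tied   = λ _ ()
  ; free≤       = λ _ → z≤n
  ; tied≤       = λ 0<m → 0<m
  ; free-avoids = λ _ _ _ → z<s
  ; tied-avoids = tied-avoids
  ; head-cases  = head-cases
  }
  where
  tied-avoids : {w : Vec ℕ n} → IsPermutation w → Leads m 0 w → HeadAvoids _>_ m 1 w
  tied-avoids {w = w} perm leads {b} b<a wb wa with w ! b | leader-last perm leads b<a wa
  ... | zero  | wb≢0 = contradiction refl wb≢0
  ... | suc _ | _    = s<s z<s

  head-cases : {w : Vec ℕ n} → IsPermutation w → m ≤ n → k ≤ m → HeadAvoids _>_ m k w →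
               k ≡ 0 ⊎ k ≡ 1 × Leads m 0 w
  head-cases {k = zero}                  perm m≤n k≤m head = inj₁ refl
  head-cases {m = m} {k = suc k} {w = w} perm m≤n k<m head =
    -- Rows 0 and `k` of `w` lie below the head row `suc k` and fail the comparison, so both lead
    -- and `k` is 0.
    inj₂ (cong suc (leads-unique {w = w} (leads ≤-refl) bottom) , bottom)
    where
    leads : x < suc k → Leads m x w
    leads x<k = headAvoids⇒leads _>_ {w = w} perm m≤n head (≤-trans x<k k<m)
      λ gt → <-asym x<k (subst (suc k <_) (punch-< x<k) gt)
    bottom = leads z<s

-- Leading rows of a `p`-avoider

module RowZero (hs v : Vec ℕ n) (m≤ : ∀ i → m ≤ hs ! i) (z : Fin n) (vz≡0 : v ! z ≡ 0) where

  ≮vz : ¬ x < v ! z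
  ≮vz lt with () ← subst (_ <_) vz≡0 lt

  -- The one in row 0 lies below `j`, so it cannot be further left than the leader at `i`, whose row
  -- is nonzero.
  before : ∀ {i} → v ! i ≡ x → 0 < x → x < j → (∀ i′ → i Fin.< i′ → j ≤ v ! i′) → z Fin.< i
  before {i = i} eq 0<x x<j late with Fin.<-cmp z i
  ... | tri< z<i _ _ = z<i
  ... | tri≈ _ refl _ = contradiction (trans (sym eq) vz≡0) (>⇒≢ 0<x)
  ... | tri> _ _ i<z = contradiction (<-≤-trans x<j (late z i<z)) ≮vz

  below : ∀ {i} → v ! i ≡ x → x < j → j ≤ m → v ! i < hs ! z
  below refl x<j j≤m = <-≤-trans x<j (≤-trans j≤m (m≤ z))

-- Two distinct nonzero leaders, the one further right and row 0 would be an
-- occurrence of p.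
leaders-agree : ∀ {hs v : Vec ℕ n} → IsAvoider _<_ hs v → 0 < n → (∀ i → m ≤ hs ! i) →
  j ≤ m → k ≤ m → Leads j x v → Leads k y v → 0 < x → 0 < y → x ≡ y
leaders-agree {j = j} {k} {x} {y} {hs} {v} V 0<n m≤ j≤m k≤m (leader i eq x<j late) (leader i′ eq′ y<k late′) 0<x 0<y
  with z , vz≡0 ← surjective V 0<n
  with Fin.<-cmp i i′
... | tri≈ _ refl _ = trans (sym eq) eq′
... | tri< i<i′ _ _ = contradiction (avoids V (before eq 0<x x<j late) i<i′ (below eq x<j j≤m) (below eq′ y<k k≤m)) ≮vz
  where open RowZero hs v m≤ z vz≡0
... | tri> _ _ i′<i = contradiction (avoids V (before eq′ 0<y y<k late′) i′<i (below eq′ y<k k≤m) (below eq x<j j≤m)) ≮vz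
  where open RowZero hs v m≤ z vz≡0

-- Equal numbers of avoiders, by induction on the board

private
  A₁ A₂ : Vec ℕ n → List (Vec ℕ n)
  A₁ = avoiders p-rule
  A₂ = avoiders p′-rule

  #leads : ℕ → ℕ → List (Vec ℕ n) → ℕ
  #leads j r V = length (filter (leads? j r) V)

  ∈A₁ : ∀ {hs v : Vec ℕ n} → IsHeights hs → v ∈ A₁ hs → IsAvoider _<_ hs v
  ∈A₁ = ∈-avoiders⁻ p-rule

  ∈A₂ : ∀ {hs v : Vec ℕ n} → IsHeights hs → v ∈ A₂ hs → IsAvoider _>_ hs v
  ∈A₂ = ∈-avoiders⁻ p′-rule

#leads-one : ∀ {hs : Vec ℕ n} {R} → 0 < n → ∀ {xs} → (∀ {v} → v ∈ xs → IsAvoider R hs v) →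
  #leads 1 0 xs ≡ length xs
#leads-one 0<n valid = length-filter-all (leads? 1 0) λ v∈ →
  let i , eq = surjective (valid v∈) 0<n
  in leader i eq z<s λ i′ i<i′ → n≢0⇒n>0 λ eq′ →
       contradiction (injective (valid v∈) (trans eq (sym eq′))) (Fin.<⇒≢ i<i′)

-- From j = 2 on, the number g of words with the favourable leader does not
-- depend on j, which is what closes the induction.
record Balanced (hs : Vec ℕ n) : Set where
  field
    same-size : length (A₁ hs) ≡ length (A₂ hs)
    g         : ℕ
    g₁ : 2 ≤ j → (∀ i → j ≤ hs ! i) → #leads j (pred j) (A₁ hs) ≡ g
    g₂ : 2 ≤ j → (∀ i → j ≤ hs ! i) → #leads j 0 (A₂ hs) ≡ g

open Balanced

balanced : (hs : Vec ℕ n) → IsHeights hs → Balanced hs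
balanced {zero} [] H = record
  { same-size = refl ; g = 0
  ; g₁ = λ _ _ → refl ; g₂ = λ _ _ → refl }
balanced {suc n} (zero ∷ hs) H = record
  { same-size = refl ; g = 0
  ; g₁ = λ _ _ → refl ; g₂ = λ _ _ → refl }
balanced {suc n} (suc m ∷ hs) H = record
  { same-size = trans (size V₁) (trans (cong₂ _+_ (same-size ih) m-leads) (sym (size V₂)))
  ; g  = #leads m (pred m) V₁
  ; g₁ = count₁
  ; g₂ = count₂
  }
  where
  H′  = isHeights-tail H
  hs′ = Vec.map pred hs
  V₁ = A₁ hs′
  V₂ = A₂ hs′
  ih = balanced hs′ H′

  m≤n : m ≤ n
  m≤n = ≤-pred (bounded H zero)

  m≤ : ∀ i → m ≤ hs′ ! i
  m≤ i rewrite lookup-map i pred hs = pred-mono-≤ (sorted H {zero} {suc i} z≤n)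

  size : ∀ {k k′ r} (V : List (Vec ℕ n)) →
    length (List.map (insert k) V ++ List.map (insert k′) (filter (leads? m r) V)) ≡ length V + #leads m r V
  size V = trans (length-++ (List.map _ V)) (cong₂ _+_ (length-map _ V) (length-map _ (filter _ V)))

  split : ∀ {k k′ r x} (V : List (Vec ℕ n)) →
    #leads j x (List.map (insert k) V ++ List.map (insert k′) (filter (leads? m r) V)) ≡
    #leads j x (List.map (insert k) V) + #leads j x (List.map (insert k′) (filter (leads? m r) V))
  split V = length-filter-++ (leads? _ _) (List.map _ V) _

  -- Nothing leads below 0; row 0 always leads below 1, so there the sizes decide; from 2 on, both
  -- numbers are the `g` of the smaller board. At `i = m` this matches the extensions by tied rows.
  same-leads : ∀ i → i ≤ n → (∀ c → i ≤ hs′ ! c) → #leads i (pred i) V₁ ≡ #leads i 0 V₂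
  same-leads 0 _ _ = trans (length-filter-none (leads? 0 0) {V₁} (λ where _ (leader _ _ () _)))
    (sym (length-filter-none (leads? 0 0) {V₂} (λ where _ (leader _ _ () _))))
  same-leads 1 0<n _ = trans (#leads-one 0<n (∈A₁ H′))
    (trans (same-size ih) (sym (#leads-one 0<n (∈A₂ H′))))
  same-leads (2+ _) _ i≤ = trans (g₁ ih (s≤s (s≤s z≤n)) i≤) (sym (g₂ ih (s≤s (s≤s z≤n)) i≤))

  m-leads = same-leads m m≤n m≤

  ∈-tied : ∀ {k r v} {V : List (Vec ℕ n)} → v ∈ List.map (insert k) (filter (leads? m r) V) →
    ∃ λ w → w ∈ V × Leads m r w × v ≡ insert k w
  ∈-tied {r = r} v∈ with w , w∈ , eq ← ∈-map⁻ _ v∈ =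
    let w∈V , leads = ∈-filter⁻ (leads? m r) w∈ in w , w∈V , leads , eq

  free-none : ∀ {k j R} {V : List (Vec ℕ n)} → (∀ {w} → w ∈ V → IsAvoider R hs′ w) → 0 < n →
    punch k 0 < j → #leads j k (List.map (insert k) V) ≡ 0
  free-none {k} {j} valid 0<n lt = length-filter-none (leads? j k) λ v∈ leads →
    let w , w∈ , eq = ∈-map⁻ _ v∈
        i , wi≡0    = surjective (valid w∈) 0<n
    in ¬leads-head {w = w} i (subst (λ x → punch k x < j) (sym wi≡0) lt) (subst (Leads j k) eq leads)

  count₁ : 2 ≤ j → (∀ i → j ≤ (suc m ∷ hs) ! i) → #leads j (pred j) (A₁ (suc m ∷ hs)) ≡ #leads m (pred m) V₁
  count₁ {j} 2≤j j≤ with m≤n⇒m<n∨m≡n (j≤ zero)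
  -- Threshold at most `m`: the free row `m` is not below it, so the free block keeps the leaders of
  -- `V₁`, and the tied block contributes nothing.
  count₁ {suc j} 2≤j@(s≤s 1≤j) j≤ | inj₁ j<m@(s≤s j≤m) = trans (split V₁) (trans (cong₂ _+_ same none) (+-identityʳ _))
    where
    0<n : 0 < n
    0<n = ≤-trans (≤-trans 1≤j (<⇒≤ j≤m)) m≤n

    same : #leads (suc j) j (List.map (insert m) V₁) ≡ #leads m (pred m) V₁
    same = trans
      (length-filter-map (leads? (suc j) j) (leads? (suc j) j) (insert m) V₁
        (λ _ leads → leads-punch-low⁻ j≤m (leads-∷⁻ (<⇒≢ j≤m) leads))
        (λ _ leads → leads-∷⁺ (leads-punch-low⁺ j≤m leads)))
      -- The induction hypothesis is used at `suc j` and at `m`: `g` does not depend on the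
      -- threshold.
      (trans (g₁ ih 2≤j (λ i → ≤-trans j≤m (m≤ i))) (sym (g₁ ih (≤-trans 2≤j j≤m) m≤)))

    none : #leads (suc j) j (List.map (insert (pred m)) (filter (leads? m (pred m)) V₁)) ≡ 0
    none = length-filter-none (leads? (suc j) j) absurd
      where
      absurd : ∀ {v} → v ∈ List.map (insert (pred m)) (filter (leads? m (pred m)) V₁) → ¬ Leads (suc j) j v
      absurd v∈ leads′ with w , w∈ , leads , refl ← ∈-tied {r = pred m} {V = V₁} v∈ with j ≟ pred m
      -- Now `j` is the row of the head, while row 0 of `w` stays in place, below the threshold and
      -- further left.
      ... | yes refl =
        let i , wi≡0 = surjective (∈A₁ H′ w∈) 0<n
        in ¬leads-head {w = w} i
             (subst (λ x → punch j x < suc j) (sym wi≡0) (subst (_< suc j) (sym (punch-< 1≤j)) z<s)) leads′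
      -- Below the inserted row nothing moves, so `w` would have `j` leading below `suc j` and
      -- `pred m` leading below `m`: two different nonzero leaders.
      ... | no j≢ =
        let j<m-1 = ≤∧≢⇒< (pred-mono-≤ j≤m) j≢
        in j≢ (sym (leaders-agree (∈A₁ H′ w∈) 0<n m≤ ≤-refl j≤m leads
                 (leads-punch-low⁻ j<m-1 (leads-∷⁻ j≢ leads′)) (≤-<-trans z≤n j<m-1) 1≤j))
  -- Threshold `suc m`, the full height: the free head `m` has row 0 to its left and cannot lead,
  -- whereas in the tied block the leader `pred m` is shifted to `m` and always leads.
  count₁ {suc j} 2≤j@(s≤s 1≤j) j≤ | inj₂ refl = trans (split V₁) (cong₂ _+_
    (free-none (∈A₁ H′) (<-≤-trans 1≤j m≤n) (subst (_< suc m) (sym (punch-< 1≤j)) z<s))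
    (trans (length-filter-all (leads? (suc m) m) λ v∈ →
      let w , w∈ , leads , eq = ∈-tied {r = pred m} {V = V₁} v∈
      in subst (Leads (suc m) m) (sym eq) (leads-∷⁺ (subst (λ r → Leads (suc m) r (Vec.map (punch (pred m)) w))
           (trans (punch-≥ ≤-refl) (suc-pred m {{>-nonZero 1≤j}})) (leads-punch pred[n]≤n leads))))
      (length-map _ (filter (leads? m (pred m)) V₁))))

  count₂ : 2 ≤ j → (∀ i → j ≤ (suc m ∷ hs) ! i) → #leads j 0 (A₂ (suc m ∷ hs)) ≡ #leads m (pred m) V₁
  -- The free head takes row 0 and pushes the old row 0 to row 1, still below the threshold and
  -- further left, so it never leads. In the tied block row 0 keeps leading past the insertion of
  -- row 1, so all words count.
  count₂ {suc j} 2≤j@(s≤s 1≤j) j≤ = trans (split V₂) (cong₂ _+_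
    (free-none (∈A₂ H′) (<-≤-trans 1≤j (≤-trans (≤-pred (j≤ zero)) m≤n)) 2≤j)
    (trans (trans (length-filter-all (leads? (suc j) 0) λ v∈ →
      let w , w∈ , leads , eq = ∈-tied {r = 0} {V = V₂} v∈ in
      subst (Leads (suc j) 0) (sym eq) (leads-∷⁺ (leads-punch 1≤j (leads-anti (≤-pred (j≤ zero)) 1≤j leads))))
      (length-map _ (filter (leads? m 0) V₂))) (sym m-leads)))

-- Vectors and reversed indices

module _ {A : Set} {P : A → Set} where

  lookup⁺-ext : {xs : Vec A n} {ps qs : VecAll.All P xs} → (∀ i → lookup⁺ ps i ≡ lookup⁺ qs i) → ps ≡ qs
  lookup⁺-ext {ps = []}    {[]}    _  = refl
  lookup⁺-ext {ps = _ ∷ _} {_ ∷ _} eq = cong₂ _∷_ (eq zero) (lookup⁺-ext (eq ∘ suc))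

  lookup⁺∘lookup⁻ : {xs : Vec A n} (f : ∀ i → P (xs ! i)) → ∀ i → lookup⁺ {P = P} {xs = xs} (lookup⁻ f) i ≡ f i
  lookup⁺∘lookup⁻ {xs = _ ∷ xs} f zero    = refl
  lookup⁺∘lookup⁻ {xs = _ ∷ xs} f (suc i) = lookup⁺∘lookup⁻ {xs = xs} (f ∘ suc) i

does-true : (d : Dec A) → does d ≡ true → A
does-true (yes a) _ = a

allPairs-lookup : ∀ {A : Set} {R : Rel A 0ℓ} {xs : Vec A n} → AllPairs R xs →
  ∀ {i j} → i Fin.< j → R (xs ! i) (xs ! j)
allPairs-lookup (px ∷ _) {zero}  {suc j} _         = lookup⁺ px j
allPairs-lookup (_ ∷ pp) {suc i} {suc j} (s<s i<j) = allPairs-lookup pp i<j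

opposite-anti-< : ∀ {i j : Fin n} → i Fin.< j → opposite j Fin.< opposite i
opposite-anti-< {i = i} {j} i<j = subst₂ _<_ (sym (Fin.opposite-prop j)) (sym (Fin.opposite-prop i))
  (∸-monoʳ-< (s<s i<j) (Fin.toℕ<n j))

opposite-anti-≤ : ∀ {i j : Fin n} → i Fin.≤ j → opposite j Fin.≤ opposite i
opposite-anti-≤ {n} {i} {j} i≤j = subst₂ _≤_ (sym (Fin.opposite-prop j)) (sym (Fin.opposite-prop i))
  (∸-monoʳ-≤ n (s≤s i≤j))

-- From boards to words

-- The height of column j of a board with row lengths ls, which are assumed
-- to be decreasing.
height : Vec ℕ n → ℕ → ℕ
height []       j = 0
height (l ∷ ls) j with j <? l
... | yes _ = suc (height ls j)
... | no  _ = 0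

height≤n : ∀ (ls : Vec ℕ n) j → height ls j ≤ n
height≤n []       j = z≤n
height≤n (l ∷ ls) j with j <? l
... | yes _ = s≤s (height≤n ls j)
... | no  _ = z≤n

height-anti : ∀ (ls : Vec ℕ n) {j j′} → j ≤ j′ → height ls j′ ≤ height ls j
height-anti []       j≤j′ = z≤n
height-anti (l ∷ ls) {j} {j′} j≤j′ with j′ <? l | j <? l
... | yes j′<l | yes _  = s≤s (height-anti ls j≤j′)
... | yes j′<l | no j≮l = contradiction (≤-<-trans j≤j′ j′<l) j≮l
... | no  _    | _      = z≤n

<height⇒<row : ∀ (ls : Vec ℕ n) {j} i → toℕ i < height ls j → j < ls ! i
<height⇒<row (l ∷ ls) {j} i       lt       with j <? l
<height⇒<row (l ∷ ls)     zero    lt       | yes j<l = j<l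
<height⇒<row (l ∷ ls)     (suc i) (s<s lt) | yes _   = <height⇒<row ls i lt

-- Here the rows must decrease: `height` stops at the first row that does not reach column `j`, and
-- then no later row reaches it.
<row⇒<height : ∀ {ls : Vec ℕ n} → AllPairs _≥_ ls → ∀ {j} i → j < ls ! i → toℕ i < height ls j
<row⇒<height {ls = l ∷ ls} (l≥ ∷ dec) {j} i lt with j <? l
<row⇒<height (l≥ ∷ dec) zero    lt | yes _   = z<s
<row⇒<height (l≥ ∷ dec) (suc i) lt | yes _   = s<s (<row⇒<height dec i lt)
<row⇒<height (l≥ ∷ dec) zero    lt | no j≮l = contradiction lt j≮l
<row⇒<height (l≥ ∷ dec) (suc i) lt | no j≮l = contradiction (<-≤-trans lt (lookup⁺ l≥ i)) j≮l

row≤firstRow : ∀ {ls : Vec ℕ n} → AllPairs _≥_ ls → ∀ i → ls ! i ≤ firstRow ls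
row≤firstRow (_  ∷ _) zero    = ≤-refl
row≤firstRow (l≥ ∷ _) (suc i) = lookup⁺ l≥ i

module _ (B : FerrersBoard n) where

  row≤n : ∀ i → rows B ! i ≤ n
  row≤n i = subst (rows B ! i ≤_) (square B) (row≤firstRow (decreasing B) i)

  heights : Vec ℕ n
  heights = Vec.tabulate λ c → height (rows B) (toℕ (opposite c))

  heights! : ∀ c → heights ! c ≡ height (rows B) (toℕ (opposite c))
  heights! = lookup∘tabulate λ c → height (rows B) (toℕ (opposite c))

  heights-isHeights : IsHeights heights
  heights-isHeights = record
    { bounded = λ c → subst (_≤ n) (sym (heights! c)) (height≤n (rows B) _)
    ; sorted  = λ {c} {c′} c≤c′ → subst₂ _≤_ (sym (heights! c)) (sym (heights! c′))
                  (height-anti (rows B) (opposite-anti-≤ {i = c} {c′} c≤c′))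
    }

  inBoard⁺ : ∀ {i c} → toℕ i < heights ! c → InBoard B i (opposite c)
  inBoard⁺ {i} {c} lt = <height⇒<row (rows B) i (subst (toℕ i <_) (heights! c) lt)

  inBoard⁻ : ∀ {i c} → InBoard B i (opposite c) → toℕ i < heights ! c
  inBoard⁻ {i} {c} lt = subst (toℕ i <_) (sym (heights! c)) (<row⇒<height (decreasing B) i lt)

  -- An occurrence of p or p′ without the sorting of its rows: cell (i₃ , j₃)
  -- always lies in the board, and columns j₁, j₂ are at least as high as j₃.
  record Occurs (R : Rel ℕ 0ℓ) (T : Filling B) : Set where
    constructor occurs
    field
      {i₁ i₂ i₃ j₁ j₂ j₃} : Fin n
      j₁<j₂   : j₁ Fin.< j₂
      j₂<j₃   : j₂ Fin.< j₃
      one₁    : One {B = B} T i₁ j₁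
      one₂    : One {B = B} T i₂ j₂
      one₃    : One {B = B} T i₃ j₃
      inside₁ : InBoard B i₁ j₃
      inside₂ : InBoard B i₂ j₃
      related : R (toℕ i₃) (toℕ i₂)

  record Represents (T : Filling B) (v : Vec ℕ n) : Set where
    field
      one⇒row : ∀ {i c} → One {B = B} T i (opposite c) → v ! c ≡ toℕ i
      row⇒one : ∀ {i c} → v ! c ≡ toℕ i → One {B = B} T i (opposite c)

  open Represents

  one-irrelevant : ∀ {T : Filling B} {i j} (p : InBoard B i j) → One {B = B} T i j → entry {B = B} T i j p ≡ true
  one-irrelevant p (_ , eq) = eq

  filling-ext : ∀ {T T′ : Filling B} →
    (∀ i j (p : InBoard B i j) → entry {B = B} T i j p ≡ entry {B = B} T′ i j p) → T ≡ T′
  filling-ext {T} {T′} eq = lookup⁺-ext λ i → lookup-ext λ k →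
    let j   = inject≤ k (row≤n i)
        j≡k = Fin.toℕ-inject≤ k (row≤n i)
        p   = subst (_< rows B ! i) (sym j≡k) (Fin.toℕ<n k)
        k≡  = Fin.toℕ-injective (trans (Fin.toℕ-fromℕ< p) j≡k)
    in subst (λ k → lookup⁺ T i ! k ≡ lookup⁺ T′ i ! k) k≡ (eq i j p)

  represents-injective : ∀ {T T′ v} → Represents T v → Represents T′ v → T ≡ T′
  represents-injective {T} {T′} rep rep′ = filling-ext λ i j p → go i j p
    where
    transfer : ∀ {T T′ v} → Represents T v → Represents T′ v → ∀ {i j} → One {B = B} T i j → One {B = B} T′ i j
    transfer {T} {T′} {v} rep rep′ {i} {j} one =
      subst (One {B = B} T′ i) (Fin.opposite-involutive j)
        (row⇒one rep′ (one⇒row rep (subst (One {B = B} T i) (sym (Fin.opposite-involutive j)) one)))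

    go : ∀ i j (p : InBoard B i j) → entry {B = B} T i j p ≡ entry {B = B} T′ i j p
    go i j p with entry {B = B} T i j p in eq | entry {B = B} T′ i j p in eq′
    ... | true  | true  = refl
    ... | false | false = refl
    ... | true  | false = trans (sym (one-irrelevant {T′} p (transfer rep rep′ (p , eq)))) eq′
    ... | false | true  = trans (sym eq) (one-irrelevant {T} p (transfer rep′ rep (p , eq′)))

  represents-functional : ∀ {T v v′} → (∀ c → v ! c < n) → Represents T v → Represents T v′ → v ≡ v′
  represents-functional v<n rep rep′ = lookup-ext λ c →
    let eq = Fin.toℕ-fromℕ< (v<n c)
    in trans (sym eq) (sym (one⇒row rep′ (row⇒one rep (sym eq))))

  transversal⇒word : ∀ {T : Filling B} → IsTransversal {B = B} T → ∃ (Represents T)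
  transversal⇒word {T} (_ , columns) = v , record
    { one⇒row = λ {i} {c} one → trans (v! c) (cong toℕ (unique c one))
    ; row⇒one = λ {i} {c} eq → subst (λ i → One {B = B} T i (opposite c))
        (Fin.toℕ-injective (trans (sym (v! c)) eq)) (proj₁ (proj₂ (columns (opposite c))))
    }
    where
    v = Vec.tabulate λ c → toℕ (proj₁ (columns (opposite c)))

    v! : ∀ c → v ! c ≡ toℕ (proj₁ (columns (opposite c)))
    v! = lookup∘tabulate λ c → toℕ (proj₁ (columns (opposite c)))

    unique : ∀ c {i} → One {B = B} T i (opposite c) → proj₁ (columns (opposite c)) ≡ i
    unique c one = proj₂ (proj₂ (columns (opposite c))) one

  word⇒filling : ∀ {v} → (∀ c → v ! c < heights ! c) → ∃ λ T → Represents T v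
  word⇒filling {v} fits = T , record
    { one⇒row = λ {i} {c} (p , e) → toEq i c (trans (sym (entry≡ i (opposite c) p)) e)
    ; row⇒one = λ {i} {c} eq →
        let p = inBoard⁺ (subst (_< heights ! c) eq (fits c))
        in p , trans (entry≡ i (opposite c) p) (fromEq i c eq)
    }
    where
    bit : Fin n → Fin n → Bool
    bit i j = does (v ! opposite j ≟ toℕ i)

    toEq : ∀ i c → bit i (opposite c) ≡ true → v ! c ≡ toℕ i
    toEq i c e rewrite Fin.opposite-involutive c = does-true (v ! c ≟ toℕ i) e

    fromEq : ∀ i c → v ! c ≡ toℕ i → bit i (opposite c) ≡ true
    fromEq i c eq rewrite Fin.opposite-involutive c = dec-true (v ! c ≟ toℕ i) eq

    row : ∀ i → Vec Bool (rows B ! i)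
    row i = Vec.tabulate λ k → bit i (inject≤ k (row≤n i))

    T : Filling B
    T = lookup⁻ row

    entry≡ : ∀ i j (p : InBoard B i j) → entry {B = B} T i j p ≡ bit i j
    entry≡ i j p = trans (cong (_! fromℕ< p) (lookup⁺∘lookup⁻ {P = Vec Bool} {xs = rows B} row i))
      (trans (lookup∘tabulate (λ k → bit i (inject≤ k (row≤n i))) (fromℕ< p))
        (cong (bit i) (Fin.toℕ-injective (trans (Fin.toℕ-inject≤ _ (row≤n i)) (Fin.toℕ-fromℕ< p)))))

  module _ (ρ : Rule) where
    open Rule ρ
    open IsAvoider

    isAvoider : ∀ {T v} → IsTransversal {B = B} T → Represents T v → ¬ Occurs R T → IsAvoider R heights v
    isAvoider {T} {v} (rows! , columns!) rep ¬occ = record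
      { permutation = record { injective = inj ; surjective = surj }
      ; fits        = λ c → let i , eq , one = at c in subst (_< heights ! c) (sym eq) (inBoard⁻ (proj₁ one))
      ; avoids      = av
      }
      where
      at : ∀ c → ∃ λ i → v ! c ≡ toℕ i × One {B = B} T i (opposite c)
      at c = let i , one , _ = columns! (opposite c) in i , one⇒row rep one , one

      inj : ∀ {c c′} → v ! c ≡ v ! c′ → c ≡ c′
      inj {c} {c′} eq =
        let i , vc , one = at c
            _ , _ , unique = rows! i
            one′ = row⇒one rep (trans (sym eq) vc)
        in trans (sym (Fin.opposite-involutive c))
             (trans (cong opposite (trans (sym (unique one)) (unique one′))) (Fin.opposite-involutive c′))

      surj : ∀ {r} → r < n → ∃ λ c → v ! c ≡ r
      surj r<n =
        let j , one , _ = rows! (fromℕ< r<n)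
        in opposite j , trans (one⇒row rep (subst (One {B = B} T _) (sym (Fin.opposite-involutive j)) one))
                              (Fin.toℕ-fromℕ< r<n)

      av : Avoids R heights v
      -- By connexity a failing comparison is reversed, and then columns `a`, `b`, `c`, which run
      -- from left to right, form an occurrence.
      av {c} {b} {a} c<b b<a vb va with R-connex (λ eq → Fin.<⇒≢ c<b (sym (inj {b} {c} eq)))
      ... | inj₁ Rbc = Rbc
      ... | inj₂ Rcb =
        let _ , eqa , onea = at a
            _ , eqb , oneb = at b
            _ , eqc , onec = at c
        in contradiction
          (occurs (opposite-anti-< {i = b} b<a) (opposite-anti-< {i = c} c<b) onea oneb onec
            (inBoard⁺ (subst (_< heights ! c) eqa va)) (inBoard⁺ (subst (_< heights ! c) eqb vb)) (subst₂ R eqc eqb Rcb))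
          ¬occ

    module _ {T v} (rep : Represents T v) (V : IsAvoider R heights v) where

      v<n : ∀ c → v ! c < n
      v<n c = <-≤-trans (fits V c) (IsHeights.bounded heights-isHeights c)

      one⇒row′ : ∀ {i j} → One {B = B} T i j → v ! opposite j ≡ toℕ i
      one⇒row′ {i} {j} one = one⇒row rep (subst (One {B = B} T i) (sym (Fin.opposite-involutive j)) one)

      isTransversal : IsTransversal {B = B} T
      isTransversal =
        (λ i → let c , vc = surjective V (Fin.toℕ<n i) in
           opposite c , row⇒one rep vc , λ {j} one →
             trans (cong opposite (injective V (trans vc (sym (one⇒row′ one))))) (Fin.opposite-involutive j)) ,
        (λ j → let eq = Fin.toℕ-fromℕ< (v<n (opposite j)) in
           fromℕ< (v<n (opposite j)) ,
           subst (One {B = B} T _) (Fin.opposite-involutive j) (row⇒one rep (sym eq)) , λ one →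
             Fin.toℕ-injective (trans eq (one⇒row′ one)))

      ¬occurs : ¬ Occurs R T
      ¬occurs (occurs {i₁} {i₂} {i₃} {j₁} {j₂} {j₃} j₁<j₂ j₂<j₃ one₁ one₂ one₃ inside₁ inside₂ related) =
        R-asym related (subst₂ R (one⇒row′ one₂) (one⇒row′ one₃)
          (avoids V (opposite-anti-< {i = j₂} j₂<j₃) (opposite-anti-< {i = j₁} j₁<j₂)
            (visible one₂ inside₂) (visible one₁ inside₁)))
        where
        visible : ∀ {i j} → One {B = B} T i j → InBoard B i j₃ → v ! opposite j < heights ! opposite j₃
        visible {i} one inside = subst (_< _) (sym (one⇒row′ one))
          (inBoard⁻ (subst (InBoard B i) (sym (Fin.opposite-involutive j₃)) inside))

    -- `Represents` pairs counted fillings with listed words and is injective from both sides, so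
    -- each list is at most as long as the other.
    #transversals≡ : {P : Pred (Filling B) 0ℓ} (P? : Decidable P) →
      (∀ {T} → IsTransversal {B = B} T → P T → ¬ Occurs R T) →
      (∀ {T} → IsTransversal {B = B} T → ¬ Occurs R T → P T) →
      #transversals B P? ≡ length (avoiders ρ heights)
    #transversals≡ {P} P? P⇒ ⇒P = ≤-antisym
      (matching⇒length-≤ Represents (Unique.filter⁺ Q? (allFillings-unique (rows B)))
        (λ T∈ → let _ , transversal , PT = ∈-filter⁻ Q? {xs = allFillings (rows B)} T∈
                    v , rep = transversal⇒word transversal
                in v , ∈-avoiders⁺ ρ heights-isHeights (isAvoider transversal rep (P⇒ transversal PT)) , rep)
        λ _ _ → represents-injective)
      (matching⇒length-≤ (λ v T → Represents T v) (avoiders-unique ρ heights)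
        (λ v∈ → let V = ∈-avoiders⁻ ρ heights-isHeights v∈
                    T , rep = word⇒filling (fits V)
                    transversal = isTransversal rep V
                in T , ∈-filter⁺ Q? (∈-allFillings T) (transversal , ⇒P transversal (¬occurs rep V)) , rep)
        λ v∈ _ rep rep′ → represents-functional (v<n rep (∈-avoiders⁻ ρ heights-isHeights v∈)) rep rep′)
      where
      Q? = λ T → isTransversal? {B = B} T ×-dec P? T

  module _ {T : Filling B} where

    contains⇒occurs : ∀ {R} {σ : Pattern 3} →
      (∀ {r} → AllPairs Fin._<_ r → R (toℕ (r ! (σ ⟨$⟩ 2F))) (toℕ (r ! (σ ⟨$⟩ 1F)))) →
      Contains B T σ → Occurs R T
    contains⇒occurs related (r , c , o) = occurs
      (allPairs-lookup c-increasing {0F} {1F} z<s) (allPairs-lookup c-increasing {1F} {2F} (s<s z<s))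
      (ones 0F) (ones 1F) (ones 2F) (inside _ 2F) (inside _ 2F) (related r-increasing)
      where open Occurrence o

    module _ {R} (transversal : IsTransversal {B = B} T) (o : Occurs R T) where
      open Occurs o

      occurs⇒contains : (σ : Pattern 3) {r₁ r₂ r₃ : Fin n} → r₁ Fin.< r₂ → r₂ Fin.< r₃ →
        let r = r₁ ∷ r₂ ∷ r₃ ∷ [] in
        r ! (σ ⟨$⟩ 0F) ≡ i₁ → r ! (σ ⟨$⟩ 1F) ≡ i₂ → r ! (σ ⟨$⟩ 2F) ≡ i₃ →
        (∀ a → r ! a ≡ i₁ ⊎ r ! a ≡ i₂ ⊎ r ! a ≡ i₃) →
        Contains B T σ
      occurs⇒contains σ {r₁} {r₂} {r₃} r₁<r₂ r₂<r₃ eq₁ eq₂ eq₃ among = rs , cs , record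
        { r-increasing = (r₁<r₂ ∷ <-trans r₁<r₂ r₂<r₃ ∷ []) ∷ (r₂<r₃ ∷ []) ∷ [] ∷ []
        ; c-increasing = (j₁<j₂ ∷ <-trans j₁<j₂ j₂<j₃ ∷ []) ∷ (j₂<j₃ ∷ []) ∷ [] ∷ []
        -- A row that reaches column `j₃` also reaches the columns to its left, so all nine cells
        -- are in the board.
        ; inside       = λ a b → ≤-<-trans (≤j₃ b) (inside-j₃ a)
        ; ones         = λ where
            0F → subst (λ i → One {B = B} T i j₁) (sym eq₁) one₁
            1F → subst (λ i → One {B = B} T i j₂) (sym eq₂) one₂
            2F → subst (λ i → One {B = B} T i j₃) (sym eq₃) one₃
        }
        where
        rs = r₁ ∷ r₂ ∷ r₃ ∷ []
        cs = j₁ ∷ j₂ ∷ j₃ ∷ []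

        ≤j₃ : ∀ b → cs ! b Fin.≤ j₃
        ≤j₃ 0F = <⇒≤ (<-trans j₁<j₂ j₂<j₃)
        ≤j₃ 1F = <⇒≤ j₂<j₃
        ≤j₃ 2F = ≤-refl

        inside-j₃ : ∀ a → InBoard B (rs ! a) j₃
        inside-j₃ a with among a
        ... | inj₁ eq        = subst (λ i → InBoard B i j₃) (sym eq) inside₁
        ... | inj₂ (inj₁ eq) = subst (λ i → InBoard B i j₃) (sym eq) inside₂
        ... | inj₂ (inj₂ eq) = subst (λ i → InBoard B i j₃) (sym eq) (proj₁ one₃)

      rows-distinct : ∀ {i i′ j j′} → One {B = B} T i j → One {B = B} T i′ j′ → j Fin.< j′ → i ≢ i′
      rows-distinct {i} one one′ j<j′ refl =
        let _ , _ , unique = proj₁ transversal i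
        in Fin.<⇒≢ j<j′ (trans (sym (unique one)) (unique one′))

      -- Column `j₁` stands for the isolated element of the POP, so its row may take any of three
      -- places around the other two; these give the three classical patterns.
      i₁-position : ∀ {lo hi} → i₁ ≢ lo → i₁ ≢ hi → lo Fin.< hi →
        i₁ Fin.< lo ⊎ lo Fin.< i₁ × i₁ Fin.< hi ⊎ hi Fin.< i₁
      i₁-position {lo} {hi} ≢lo ≢hi lo<hi with Fin.<-cmp i₁ lo | Fin.<-cmp i₁ hi
      ... | tri< <lo _ _ | _            = inj₁ <lo
      ... | tri≈ _ ≡lo _ | _            = contradiction ≡lo ≢lo
      ... | tri> _ _ >lo | tri< <hi _ _ = inj₂ (inj₁ (>lo , <hi))
      ... | tri> _ _ >lo | tri≈ _ ≡hi _ = contradiction ≡hi ≢hi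
      ... | tri> _ _ >lo | tri> _ _ >hi = inj₂ (inj₂ >hi)

      i₁≢i₂ : i₁ ≢ i₂
      i₁≢i₂ = rows-distinct one₁ one₂ j₁<j₂

      i₁≢i₃ : i₁ ≢ i₃
      i₁≢i₃ = rows-distinct one₁ one₃ (<-trans j₁<j₂ j₂<j₃)

-- The three linear extensions of each POP

pattern is₁ = inj₁ refl
pattern is₂ = inj₂ (inj₁ refl)
pattern is₃ = inj₂ (inj₂ refl)

module _ {B : FerrersBoard n} {T : Filling B} where

  occurs⇒132∣231∣321 : IsTransversal {B = B} T → Occurs B _<_ T →
    Contains B T (proj₂ pattern132) ⊎ Contains B T (proj₂ pattern231) ⊎ Contains B T (proj₂ pattern321)
  occurs⇒132∣231∣321 t o with i₁-position B t o (i₁≢i₃ B t o) (i₁≢i₂ B t o) (Occurs.related o)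
  ... | inj₁ i₁<i₃ = inj₁ (occurs⇒contains B t o _ i₁<i₃ (Occurs.related o) refl refl refl
    λ where 0F → is₁ ; 1F → is₃ ; 2F → is₂)
  ... | inj₂ (inj₁ (i₃<i₁ , i₁<i₂)) = inj₂ (inj₁ (occurs⇒contains B t o _ i₃<i₁ i₁<i₂ refl refl refl
    λ where 0F → is₃ ; 1F → is₁ ; 2F → is₂))
  ... | inj₂ (inj₂ i₂<i₁) = inj₂ (inj₂ (occurs⇒contains B t o _ (Occurs.related o) i₂<i₁ refl refl refl
    λ where 0F → is₃ ; 1F → is₂ ; 2F → is₁))

  occurs⇒123∣213∣312 : IsTransversal {B = B} T → Occurs B _>_ T →
    Contains B T (proj₂ pattern123) ⊎ Contains B T (proj₂ pattern213) ⊎ Contains B T (proj₂ pattern312)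
  occurs⇒123∣213∣312 t o with i₁-position B t o (i₁≢i₂ B t o) (i₁≢i₃ B t o) (Occurs.related o)
  ... | inj₁ i₁<i₂ = inj₁ (occurs⇒contains B t o _ i₁<i₂ (Occurs.related o) refl refl refl
    λ where 0F → is₁ ; 1F → is₂ ; 2F → is₃)
  ... | inj₂ (inj₁ (i₂<i₁ , i₁<i₃)) = inj₂ (inj₁ (occurs⇒contains B t o _ i₂<i₁ i₁<i₃ refl refl refl
    λ where 0F → is₂ ; 1F → is₁ ; 2F → is₃))
  ... | inj₂ (inj₂ i₃<i₁) = inj₂ (inj₂ (occurs⇒contains B t o _ (Occurs.related o) i₃<i₁ refl refl refl
    λ where 0F → is₂ ; 1F → is₃ ; 2F → is₁))

  containsPOP⇒occurs-p : ContainsPOP B T p → Occurs B _<_ T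
  containsPOP⇒occurs-p (σ , extends , contains) = contains⇒occurs B {σ = σ}
    (λ r-inc → allPairs-lookup r-inc (extends 2F 1F (inj₂ (refl , refl) , λ ()))) contains

  containsPOP⇒occurs-p′ : ContainsPOP B T p′ → Occurs B _>_ T
  containsPOP⇒occurs-p′ (σ , extends , contains) = contains⇒occurs B {σ = σ}
    (λ r-inc → allPairs-lookup r-inc (extends 1F 2F (inj₂ (refl , refl) , λ ()))) contains

-- Counting avoiders of POPs and of pattern sets

module _ (ρ : Rule) (B : FerrersBoard n) where
  open Rule ρ

  #transversals-avoidsPOP : (q : POP 3) →
    (∀ {T} → ContainsPOP B T q → Occurs B R T) →
    (∀ {T} → IsTransversal {B = B} T → Occurs B R T → ContainsPOP B T q) →
    #transversals B (avoidsPOP? B q) ≡ length (avoiders ρ (heights B))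
  #transversals-avoidsPOP q contains⇒ ⇒contains = #transversals≡ B ρ (avoidsPOP? B q)
    (λ t av → av ∘ ⇒contains t)
    (λ t ¬occ → ¬occ ∘ contains⇒)

  #transversals-avoidsAll : (α β γ : ∃ Pattern) →
    (∀ {T} → Contains B T (proj₂ α) → Occurs B R T) →
    (∀ {T} → Contains B T (proj₂ β) → Occurs B R T) →
    (∀ {T} → Contains B T (proj₂ γ) → Occurs B R T) →
    (∀ {T} → IsTransversal {B = B} T → Occurs B R T →
      Contains B T (proj₂ α) ⊎ Contains B T (proj₂ β) ⊎ Contains B T (proj₂ γ)) →
    #transversals B (avoidsAll? B (α ∷ β ∷ γ ∷ [])) ≡ length (avoiders ρ (heights B))
  #transversals-avoidsAll α β γ α⇒ β⇒ γ⇒ ⇒contains = #transversals≡ B ρ (avoidsAll? B (α ∷ β ∷ γ ∷ []))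
    (λ where t (¬α ∷ ¬β ∷ ¬γ ∷ []) occ → Sum.[ ¬α , Sum.[ ¬β , ¬γ ] ] (⇒contains t occ))
    (λ t ¬occ → (¬occ ∘ α⇒) ∷ (¬occ ∘ β⇒) ∷ (¬occ ∘ γ⇒) ∷ [])

same-size-heights : (B : FerrersBoard n) →
  length (avoiders p-rule (heights B)) ≡ length (avoiders p′-rule (heights B))
same-size-heights B = Balanced.same-size (balanced (heights B) (heights-isHeights B))

module _ (B : FerrersBoard n) where

  132⇒p : ∀ {T} → Contains B T (proj₂ pattern132) → ContainsPOP B T p
  132⇒p c = proj₂ pattern132 , from-yes (linearExtension? p (proj₂ pattern132)) , c

  231⇒p : ∀ {T} → Contains B T (proj₂ pattern231) → ContainsPOP B T p
  231⇒p c = proj₂ pattern231 , from-yes (linearExtension? p (proj₂ pattern231)) , c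

  321⇒p : ∀ {T} → Contains B T (proj₂ pattern321) → ContainsPOP B T p
  321⇒p c = proj₂ pattern321 , from-yes (linearExtension? p (proj₂ pattern321)) , c

  123⇒p′ : ∀ {T} → Contains B T (proj₂ pattern123) → ContainsPOP B T p′
  123⇒p′ c = proj₂ pattern123 , from-yes (linearExtension? p′ (proj₂ pattern123)) , c

  213⇒p′ : ∀ {T} → Contains B T (proj₂ pattern213) → ContainsPOP B T p′
  213⇒p′ c = proj₂ pattern213 , from-yes (linearExtension? p′ (proj₂ pattern213)) , c

  312⇒p′ : ∀ {T} → Contains B T (proj₂ pattern312) → ContainsPOP B T p′
  312⇒p′ c = proj₂ pattern312 , from-yes (linearExtension? p′ (proj₂ pattern312)) , c

  #avoiding-p : #transversals B (avoidsPOP? B p) ≡ length (avoiders p-rule (heights B))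
  #avoiding-p = #transversals-avoidsPOP p-rule B p containsPOP⇒occurs-p
    λ t → Sum.[ 132⇒p , Sum.[ 231⇒p , 321⇒p ] ] ∘ occurs⇒132∣231∣321 t

  #avoiding-p′ : #transversals B (avoidsPOP? B p′) ≡ length (avoiders p′-rule (heights B))
  #avoiding-p′ = #transversals-avoidsPOP p′-rule B p′ containsPOP⇒occurs-p′
    λ t → Sum.[ 123⇒p′ , Sum.[ 213⇒p′ , 312⇒p′ ] ] ∘ occurs⇒123∣213∣312 t

  #avoiding-132-231-321 : #transversals B (avoidsAll? B (pattern132 ∷ pattern231 ∷ pattern321 ∷ [])) ≡
    length (avoiders p-rule (heights B))
  #avoiding-132-231-321 = #transversals-avoidsAll p-rule B pattern132 pattern231 pattern321
    (containsPOP⇒occurs-p ∘ 132⇒p) (containsPOP⇒occurs-p ∘ 231⇒p) (containsPOP⇒occurs-p ∘ 321⇒p)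
    occurs⇒132∣231∣321

  #avoiding-123-213-312 : #transversals B (avoidsAll? B (pattern123 ∷ pattern213 ∷ pattern312 ∷ [])) ≡
    length (avoiders p′-rule (heights B))
  #avoiding-123-213-312 = #transversals-avoidsAll p′-rule B pattern123 pattern213 pattern312
    (containsPOP⇒occurs-p′ ∘ 123⇒p′) (containsPOP⇒occurs-p′ ∘ 213⇒p′) (containsPOP⇒occurs-p′ ∘ 312⇒p′)
    occurs⇒123∣213∣312

theorem1p6 : (p ∼ₛ p′) × (pattern132 ∷ pattern231 ∷ pattern321 ∷ [] ≈ₛ pattern123 ∷ pattern213 ∷ pattern312 ∷ [])
theorem1p6 =
  (λ B → trans (#avoiding-p B) (trans (same-size-heights B) (sym (#avoiding-p′ B)))) ,
  (λ B → trans (#avoiding-132-231-321 B) (trans (same-size-heights B) (sym (#avoiding-123-213-312 B))))
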